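{- Let $\mathbb{V}$ be a vector space of dimension $n\ge 3$ over the field of $2$ elements, with basis $\{b_1,\dots,b_n\}$, and let $G(\mathbb{V})$ be its non-zero component graph. Then $fxd(G(\mathbb{V}))=2^{n-1}$.
   Context: The non-zero component graph $G(\mathbb{V})$ (with respect to the basis $\{b_1,\dots,b_n\}$) has as vertices the non-zero vectors of $\mathbb{V}$; two distinct vertices are adjacent iff some $b_j$ has non-zero coefficient in both of their expansions in the basis. For a graph $G$, a set $D\subseteq V(G)$ is a fixing set of $G$ if the only automorphism of $G$ that fixes every vertex of $D$ is the identity. The fixed number $fxd(G)$ is the minimum number $k$ such that every subset of $V(G)$ of cardinality $k$ is a fixing set of $G$. -}

module Defs where

open import Algebra.Bundles using (CommutativeRing)
open import Algebra.Module.Bundles using (Module)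
import Algebra.Properties.CommutativeMonoid.Sum as Sum
import Algebra.Properties.Group as GroupProperties
open import Data.Bool.Properties using (xor-∧-commutativeRing)
open import Data.Fin.Base using (Fin)
open import Data.Nat.Base using (ℕ; _≤_)
open import Data.Product.Base using (Σ; ∃-syntax; _×_; _,_; proj₁; proj₂)
open import Data.Vec.Functional using (Vector)
open import Function.Base using (_∘_)
open import Function.Bundles using (Inverse; _⇔_)
open import Level using (Level; 0ℓ; _⊔_; suc)
open import Relation.Binary.Bundles using (Setoid)
open import Relation.Binary.Core using (Rel)
open import Relation.Binary.Definitions using (Symmetric; _Respects_; _Respects₂_)
import Relation.Binary.Construct.On as On
import Relation.Binary.PropositionalEquality.Properties as ≡
open import Relation.Nullary.Negation.Core using (¬_)
open import Relation.Unary using (Pred)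

private
  variable
    r ℓr m ℓm : Level

record Graph (v ℓ e : Level) : Set (suc (v ⊔ ℓ ⊔ e)) where
  field
    vertices : Setoid v ℓ
  open Setoid vertices public using (_≈_) renaming (Carrier to Vertex)
  field
    Adjacent      : Rel Vertex e
    adjacent-resp : Adjacent Respects₂ _≈_
    symmetric     : Symmetric Adjacent
    loopless      : ∀ {x y} → x ≈ y → ¬ Adjacent x y

module _ {v ℓ e : Level} (G : Graph v ℓ e) where
  open Graph G

  record Automorphism : Set (v ⊔ ℓ ⊔ e) where
    field
      bijection : Inverse vertices vertices
    open Inverse bijection public
    field
      preserves : ∀ x y → Adjacent x y ⇔ Adjacent (to x) (to y)

  -- Every finite set of vertices is already the extension of a predicate at
  -- the level of vertex equality, so the choice of that level loses nothing.
  record VertexSet : Set (v ⊔ suc ℓ) where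
    field
      _∋_    : Pred Vertex ℓ
      ∋-resp : _∋_ Respects _≈_

    elements : Setoid (v ⊔ ℓ) ℓ
    elements = On.setoid {B = Σ Vertex _∋_} vertices proj₁

  HasCardinality : VertexSet → ℕ → Set (v ⊔ ℓ)
  HasCardinality D k = Inverse (≡.setoid (Fin k)) (VertexSet.elements D)

  IsFixingSet : VertexSet → Set (v ⊔ ℓ ⊔ e)
  IsFixingSet D = ∀ (σ : Automorphism) → let open Automorphism σ in
    (∀ x → D ∋ x → to x ≈ x) → ∀ x → to x ≈ x
    where open VertexSet

  AllFixing : ℕ → Set (v ⊔ suc ℓ ⊔ e)
  AllFixing k = ∀ D → HasCardinality D k → IsFixingSet D

  -- fxd(G) = k
  IsFixedNumber : ℕ → Set (v ⊔ suc ℓ ⊔ e)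
  IsFixedNumber k = AllFixing k × (∀ j → AllFixing j → k ≤ j)

module _ {R : CommutativeRing r ℓr} (V : Module R m ℓm) where
  open CommutativeRing R
    using (Carrier; _≈_; _≉_; 0#; _+_; _-_; +-assoc; +-congˡ; +-identityʳ; -‿inverseˡ; +-group)
    renaming (trans to ≈-trans; sym to ≈-sym)
  open Module V
  open Sum +ᴹ-commutativeMonoid using (sum; sum-cong-≋; ∑-distrib-+)

  linearCombination : ∀ {n} → Vector Carrier n → Vector Carrierᴹ n → Carrierᴹ
  linearCombination c b = sum (λ i → c i *ₗ b i)

  record IsBasis {n : ℕ} (b : Vector Carrierᴹ n) : Set (r ⊔ ℓr ⊔ m ⊔ ℓm) where
    field
      independent : ∀ c → linearCombination c b ≈ᴹ 0ᴹ → ∀ i → c i ≈ 0#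
      spanning    : ∀ x → ∃[ c ] x ≈ᴹ linearCombination c b

    coefficient : Carrierᴹ → Vector Carrier n
    coefficient x = proj₁ (spanning x)

    expansion-unique : ∀ c d → linearCombination c b ≈ᴹ linearCombination d b →
                       ∀ i → c i ≈ d i
    expansion-unique c d eq i =
      GroupProperties.x∙y⁻¹≈ε⇒x≈y +-group (c i) (d i) (independent c-d diff≈0 i)
      where
      open import Relation.Binary.Reasoning.Setoid ≈ᴹ-setoid
      c-d : Vector Carrier n
      c-d j = c j - d j
      cancel : ∀ j → c-d j + d j ≈ c j
      cancel j = ≈-trans (+-assoc _ _ _)
                   (≈-trans (+-congˡ (-‿inverseˡ (d j))) (+-identityʳ (c j)))
      diff≈0 : linearCombination c-d b ≈ᴹ 0ᴹ
      diff≈0 = GroupProperties.identityˡ-unique +ᴹ-group _ (linearCombination d b) (begin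
        linearCombination c-d b +ᴹ linearCombination d b
          ≈⟨ ∑-distrib-+ (λ j → c-d j *ₗ b j) (λ j → d j *ₗ b j) ⟨
        sum (λ j → c-d j *ₗ b j +ᴹ d j *ₗ b j)
          ≈⟨ sum-cong-≋ (λ j → *ₗ-distribʳ (b j) (c-d j) (d j)) ⟨
        linearCombination (λ j → c-d j + d j) b
          ≈⟨ sum-cong-≋ (λ j → *ₗ-congʳ (cancel j)) ⟩
        linearCombination c b
          ≈⟨ eq ⟩
        linearCombination d b ∎)

    coefficient-cong : ∀ {x y} → x ≈ᴹ y → ∀ i → coefficient x i ≈ coefficient y i
    coefficient-cong {x} {y} x≈y = expansion-unique _ _
      (≈ᴹ-trans (≈ᴹ-sym (proj₂ (spanning x))) (≈ᴹ-trans x≈y (proj₂ (spanning y))))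

  nonZeroComponentGraph : ∀ {n} {b : Vector Carrierᴹ n} → IsBasis b → Graph (m ⊔ ℓm) ℓm (ℓr ⊔ ℓm)
  nonZeroComponentGraph basis = record
    { vertices      = On.setoid {B = Σ Carrierᴹ (_≉ᴹ 0ᴹ)} ≈ᴹ-setoid proj₁
    ; Adjacent      = λ (x , _) (y , _) →
        x ≉ᴹ y × ∃[ j ] (coefficient x j ≉ 0# × coefficient y j ≉ 0#)
    ; adjacent-resp =
          (λ y≈z (x≉y , j , xj , yj) →
            (λ x≈z → x≉y (≈ᴹ-trans x≈z (≈ᴹ-sym y≈z))) , j , xj , transport y≈z j yj)
        , (λ x≈z (x≉y , j , xj , yj) →
            (λ z≈y → x≉y (≈ᴹ-trans x≈z z≈y)) , j , transport x≈z j xj , yj)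
    ; symmetric     = λ (x≉y , j , xj , yj) → x≉y ∘ ≈ᴹ-sym , j , yj , xj
    ; loopless      = λ x≈y (x≉y , _) → x≉y x≈y
    }
    where
    open IsBasis basis
    transport : ∀ {x y} → x ≈ᴹ y → ∀ j → coefficient x j ≉ 0# → coefficient y j ≉ 0#
    transport x≈y j xj≉0 yj≈0 = xj≉0 (≈-trans (coefficient-cong x≈y j) yj≈0)

𝔽₂ : CommutativeRing 0ℓ 0ℓ
𝔽₂ = xor-∧-commutativeRing

{-# OPTIONS --safe #-}

-- A vertex is a nonempty set of basis indices, and two vertices meet when these
-- sets intersect. An automorphism preserves meeting in both directions, so it
-- sends singletons to singletons; if it sends {i} to {j}, every vertex it fixes
-- contains i iff it contains j. When i ≢ j, deleting the coordinate i injects the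
-- fixed vertices into the nonzero vectors of length n - 1, of which there are
-- 2 ^ (n - 1) - 1. Conversely, exchanging the first two coordinates fixes that
-- many vertices: the nonzero vectors with the first coordinate repeated.

module Submission where

open import Defs
open import Algebra.Module.Bundles using (Module)
import Algebra.Properties.CommutativeMonoid.Sum as Sum
open import Data.Bool.Base using (Bool; true; false)
open import Data.Bool.Properties using (¬-not; not-¬; ⇔→≡) renaming (_≟_ to _≟ᵇ_)
open import Data.Fin.Base using (Fin; zero; suc; pinch; punchIn; punchOut; inject≤; combine; funToFin; finToFun)
open import Data.Fin.Patterns using (0F; 1F)
open import Data.Fin.Permutation using (Permutation′; flip; transpose; _⟨$⟩ʳ_; _⟨$⟩ˡ_; inverseʳ; inverseˡ)
open import Data.Fin.Properties using (_≟_; any?; 2↔Bool; funToFin-finToFin; finToFun-funToFin; punchIn-injective; punchInᵢ≢i; punchIn-punchOut; punchOut-injective; inject≤-injective; injective⇒≤)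
open import Data.Nat.Base using (ℕ; zero; suc; _≥_; _∸_; _^_; _<_; s≤s)
open import Data.Nat.Properties using (1+n≰n; ≮⇒≥)
open import Data.Product.Base using (Σ-syntax; ∃-syntax; _×_; _,_; proj₁; proj₂; map)
open import Data.Vec.Functional using (Vector; removeAt)
open import Data.Vec.Functional.Properties using (≗-dec)
open import Function.Base using (_∘_; const; id)
open import Function.Bundles using (Inverse; Equivalence; _⇔_; mk⇔)
open import Function.Construct.Symmetry using (⇔-sym)
open import Function.Definitions using (Injective)
open import Level using (Level)
open import Relation.Binary.PropositionalEquality.Core using (_≡_; _≢_; _≗_; refl; sym; trans; cong; cong₂; subst)
open import Relation.Nullary.Decidable.Core using (Dec; yes; no; does; map′)
open import Relation.Nullary.Decidable using (dec-true)
open import Relation.Nullary.Negation.Core using (¬_; contradiction)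

-- Boolean vectors of length `k` as elements of `Fin (2 ^ k)`.

funToFin-cong : ∀ {k m} {f g : Fin k → Fin m} → f ≗ g → funToFin f ≡ funToFin g
funToFin-cong {zero}  f≗g = refl
funToFin-cong {suc k} f≗g = cong₂ combine (f≗g zero) (funToFin-cong (f≗g ∘ suc))

encode : ∀ {k} → Vector Bool k → Fin (2 ^ k)
encode c = funToFin (Inverse.from 2↔Bool ∘ c)

decode : ∀ {k} → Fin (2 ^ k) → Vector Bool k
decode i = Inverse.to 2↔Bool ∘ finToFun i

encode-cong : ∀ {k} {c d : Vector Bool k} → c ≗ d → encode c ≡ encode d
encode-cong c≗d = funToFin-cong (cong (Inverse.from 2↔Bool) ∘ c≗d)

decode-encode : ∀ {k} (c : Vector Bool k) → decode (encode c) ≗ c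
decode-encode c i =
  trans (cong (Inverse.to 2↔Bool) (finToFun-funToFin (Inverse.from 2↔Bool ∘ c) i))
        (Inverse.strictlyInverseˡ 2↔Bool (c i))

encode-decode : ∀ {k} (i : Fin (2 ^ k)) → encode {k} (decode i) ≡ i
encode-decode {k} i =
  trans (funToFin-cong (Inverse.strictlyInverseʳ 2↔Bool ∘ finToFun {2} {k} i))
        (funToFin-finToFin {k} {2} i)

encode-injective : ∀ {k} (c d : Vector Bool k) → encode c ≡ encode d → c ≗ d
encode-injective c d eq i =
  trans (sym (decode-encode c i)) (trans (cong (λ x → decode x i) eq) (decode-encode d i))

decode-injective : ∀ {k} {i j : Fin (2 ^ k)} → decode {k} i ≗ decode j → i ≡ j
decode-injective {k} {i} {j} eq =
  trans (sym (encode-decode {k} i)) (trans (encode-cong eq) (encode-decode {k} j))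

-- Pigeonhole counts, and vectors recovered from a deletion.

injective⇒hits : ∀ {N} {f : Fin N → Fin N} → Injective _≡_ _≡_ f →
                 ∀ z → ¬ (∀ i → z ≢ f i)
-- Removing the missed value `z` with `punchOut` would inject `Fin (suc N)` into `Fin N`.
injective⇒hits {suc N} inj z avoids =
  1+n≰n (injective⇒≤ λ {i} {j} eq → inj (punchOut-injective (avoids i) (avoids j) eq))

-- `punchIn z` enumerates the other `N - 1` values, and `j < N` leaves room for `j` of them.
<⇒injection-avoiding : ∀ {j N} → j < N → (z : Fin N) →
  Σ[ f ∈ (Fin j → Fin N) ] Injective _≡_ _≡_ f × (∀ i → f i ≢ z)
<⇒injection-avoiding (s≤s j≤N) z =
  (λ i → punchIn z (inject≤ i j≤N)) ,
  (λ eq → inject≤-injective j≤N j≤N _ _ (punchIn-injective z _ _ eq)) ,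
  (λ i → punchInᵢ≢i z (inject≤ i j≤N))

≗-off : ∀ {n i} (c d : Vector Bool (suc n)) → removeAt c i ≗ removeAt d i →
        ∀ {l} → i ≢ l → c l ≡ d l
≗-off c d eq i≢l =
  trans (cong c (sym (punchIn-punchOut i≢l)))
    (trans (eq (punchOut i≢l)) (cong d (punchIn-punchOut i≢l)))

-- Position `j` survives the deletion of `i`, and the repeated entry then restores position `i`.
≗-from-removeAt : ∀ {n i j} → i ≢ j → (c d : Vector Bool (suc n)) →
  c i ≡ c j → d i ≡ d j → removeAt c i ≗ removeAt d i → c ≗ d
≗-from-removeAt {i = i} i≢j c d cᵢ≡cⱼ dᵢ≡dⱼ eq l with i ≟ l
... | no  i≢l  = ≗-off c d eq i≢l
... | yes refl = trans cᵢ≡cⱼ (trans (≗-off c d eq i≢j) (sym dᵢ≡dⱼ))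

-- Vertices as nonempty sets of basis indices.

module _ {m ℓm : Level} (V : Module 𝔽₂ m ℓm) where
  open Module V
  open Sum +ᴹ-commutativeMonoid using (sum-cong-≋; sum-replicate-zero)

  module Coordinates {n : ℕ} {b : Vector Carrierᴹ n} (basis : IsBasis V b) where
    open IsBasis basis

    G : Graph _ _ _
    G = nonZeroComponentGraph V basis

    open Graph G

    combination : Vector Bool n → Carrierᴹ
    combination c = linearCombination V c b

    combination-cong : ∀ {c d} → c ≗ d → combination c ≈ᴹ combination d
    combination-cong c≗d = sum-cong-≋ (λ i → *ₗ-congʳ (c≗d i))

    combination-zero : combination (const false) ≈ᴹ 0ᴹ
    combination-zero = ≈ᴹ-trans (sum-cong-≋ (λ i → *ₗ-zeroˡ (b i))) (sum-replicate-zero n)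

    coefficient-combination : ∀ c → coefficient (combination c) ≗ c
    coefficient-combination c i =
      sym (expansion-unique c _ (proj₂ (spanning (combination c))) i)

    coefficient-injective : ∀ {x y} → coefficient x ≗ coefficient y → x ≈ᴹ y
    coefficient-injective {x} {y} eq =
      ≈ᴹ-trans (proj₂ (spanning x))
        (≈ᴹ-trans (combination-cong eq) (≈ᴹ-sym (proj₂ (spanning y))))

    coord : Vertex → Vector Bool n
    coord (x , _) = coefficient x

    infix 4 _∈_
    _∈_ : Fin n → Vertex → Set
    i ∈ x = coord x i ≡ true

    -- The relation x ≈ y compares underlying vectors only, so the vertices x and y
    -- cannot be inferred from it and are explicit arguments below.
    ∈-resp : ∀ {i} x y → x ≈ y → i ∈ x → i ∈ y
    ∈-resp {i} x y x≈y = trans (sym (coefficient-cong x≈y i))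

    ∈-extensional : ∀ x y → (∀ i → i ∈ x ⇔ i ∈ y) → x ≈ y
    ∈-extensional x y x⇔y = coefficient-injective (λ i → ⇔→≡ (x⇔y i))

    -- If a finite search finds no `true` coefficient, the vector is the zero combination, which
    -- `x≉0` excludes.
    nonempty : ∀ x → ∃[ i ] i ∈ x
    nonempty (x , x≉0) with any? (λ i → coefficient x i ≟ᵇ true)
    ... | yes i∈x = i∈x
    ... | no ∄i   = contradiction
      (≈ᴹ-trans (proj₂ (spanning x))
        (≈ᴹ-trans (combination-cong (λ i → ¬-not (∄i ∘ (i ,_)))) combination-zero))
      x≉0

    vertex : (c : Vector Bool n) → ∃[ i ] c i ≡ true → Vertex
    vertex c (i , cᵢ) = combination c , λ c≈0 →
      contradiction (trans (sym cᵢ) (independent c c≈0 i)) λ ()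

    singleton : Fin n → Vertex
    singleton i = vertex (λ j → does (i ≟ j)) (i , dec-true (i ≟ i) refl)

    ∈-singleton⇔ : ∀ i j → j ∈ singleton i ⇔ i ≡ j
    ∈-singleton⇔ i j = mk⇔
      (λ j∈ → reflects (i ≟ j) (trans (sym (coefficient-combination _ j)) j∈))
      (λ i≡j → trans (coefficient-combination _ j) (dec-true (i ≟ j) i≡j))
      where
      reflects : ∀ {a} {A : Set a} (A? : Dec A) → does A? ≡ true → A
      reflects (yes a) _ = a

    -- `x` has some element, and it can only be `i`, so one inclusion already gives equality.
    subset-singleton : ∀ {i} x → (∀ k → k ∈ x → i ≡ k) → x ≈ singleton i
    subset-singleton {i} x x⊆i = ∈-extensional x (singleton i) λ k → mk⇔
      (Equivalence.from (∈-singleton⇔ i k) ∘ x⊆i k)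
      (λ k∈ → i⊆x (Equivalence.to (∈-singleton⇔ i k) k∈))
      where
      i⊆x : ∀ {k} → i ≡ k → k ∈ x
      i⊆x refl with nonempty x
      ... | j , j∈x with refl ← x⊆i j j∈x = j∈x

    -- Equality of vectors is decided through their finitely many Boolean coordinates;
    -- `meets-preserved` splits on it.
    _≈?_ : ∀ x y → Dec (x ≈ y)
    x ≈? y = map′ coefficient-injective coefficient-cong (≗-dec _≟ᵇ_ (coord x) (coord y))

    -- The reflexive version of adjacency: it also relates equal vertices, so arguments with
    -- singletons need no distinctness check.
    Meets : Vertex → Vertex → Set
    Meets x y = ∃[ i ] i ∈ x × i ∈ y

    meets-respʳ : ∀ x y y′ → y ≈ y′ → Meets x y → Meets x y′
    meets-respʳ x y y′ y≈y′ (i , i∈x , i∈y) = i , i∈x , ∈-resp y y′ y≈y′ i∈y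

    ∈⇔meets : ∀ i x → i ∈ x ⇔ Meets x (singleton i)
    ∈⇔meets i x = mk⇔
      (λ i∈x → i , i∈x , Equivalence.from (∈-singleton⇔ i i) refl)
      (λ (j , j∈x , j∈i) → subst (_∈ x) (sym (Equivalence.to (∈-singleton⇔ i j) j∈i)) j∈x)

    ≈⇒meets : ∀ x y → x ≈ y → Meets x y
    ≈⇒meets x y x≈y with i , i∈x ← nonempty x = i , i∈x , ∈-resp x y x≈y i∈x

    adjacent⇒meets : ∀ x y → Adjacent x y → Meets x y
    adjacent⇒meets x y (_ , i , xᵢ , yᵢ) = i , ¬-not xᵢ , ¬-not yᵢ

    meets⇒adjacent : ∀ x y → ¬ x ≈ y → Meets x y → Adjacent x y
    meets⇒adjacent x y x≉y (i , i∈x , i∈y) = x≉y , i , not-¬ i∈x , not-¬ i∈y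

    -- The action of an automorphism on singletons.

    module _ (σ : Automorphism G) where
      open Automorphism σ using (to; from; to-cong; from-cong; strictlyInverseˡ; strictlyInverseʳ; preserves)

      to-injective : ∀ x y → to x ≈ to y → x ≈ y
      to-injective x y eq =
        ≈ᴹ-trans (≈ᴹ-sym (strictlyInverseʳ x)) (≈ᴹ-trans (from-cong eq) (strictlyInverseʳ y))

      -- Equal vertices meet, and so do their equal images. Distinct vertices have distinct images,
      -- so there meeting is adjacency on both sides.
      meets-preserved : ∀ x y → Meets x y ⇔ Meets (to x) (to y)
      meets-preserved x y with x ≈? y
      ... | yes x≈y = mk⇔ (λ _ → ≈⇒meets (to x) (to y) (to-cong x≈y)) (λ _ → ≈⇒meets x y x≈y)
      ... | no  x≉y = mk⇔
        (adjacent⇒meets (to x) (to y) ∘ Equivalence.to (preserves x y) ∘ meets⇒adjacent x y x≉y)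
        (adjacent⇒meets x y ∘ Equivalence.from (preserves x y) ∘
          meets⇒adjacent (to x) (to y) (x≉y ∘ to-injective x y))

      -- Every k in the preimage C of {j} equals i: the image of {k} contains j, so it
      -- meets the image of {i}. Hence C is {i}.
      singleton-image : ∀ i j → j ∈ to (singleton i) → to (singleton i) ≈ singleton j
      singleton-image i j j∈ =
        ≈ᴹ-trans (to-cong (≈ᴹ-sym (subset-singleton C C⊆i))) (strictlyInverseˡ (singleton j))
        where
        C : Vertex
        C = from (singleton j)
        C⊆i : ∀ k → k ∈ C → i ≡ k
        C⊆i k k∈C = Equivalence.to (∈-singleton⇔ i k) (Equivalence.from (∈⇔meets k (singleton i))
          (Equivalence.from (meets-preserved (singleton i) (singleton k)) (j , j∈ , j∈k)))
          where
          j∈k : j ∈ to (singleton k)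
          j∈k with l , l∈toC , l∈k ←
                 Equivalence.to (meets-preserved C (singleton k)) (Equivalence.to (∈⇔meets k C) k∈C)
              with refl ← Equivalence.to (∈-singleton⇔ j l) (∈-resp (to C) (singleton j) (strictlyInverseˡ (singleton j)) l∈toC)
              = l∈k

      -- `i ∈ x` says that `x` meets `{i}`; meeting is preserved, and the image of `{i}` is `{j}`.
      ∈⇔∈-image : ∀ {i j} → j ∈ to (singleton i) → ∀ x → i ∈ x ⇔ j ∈ to x
      ∈⇔∈-image {i} {j} j∈ x = mk⇔
        (Equivalence.from (∈⇔meets j (to x)) ∘ meets-respʳ (to x) (to (singleton i)) (singleton j) image ∘
          Equivalence.to (meets-preserved x (singleton i)) ∘ Equivalence.to (∈⇔meets i x))
        (Equivalence.from (∈⇔meets i x) ∘ Equivalence.from (meets-preserved x (singleton i)) ∘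
          meets-respʳ (to x) (singleton j) (to (singleton i)) (≈ᴹ-sym image) ∘ Equivalence.to (∈⇔meets j (to x)))
        where
        image : to (singleton i) ≈ singleton j
        image = singleton-image i j j∈

      fixed-coord : ∀ {i j} → j ∈ to (singleton i) → ∀ x → to x ≈ x → coord x i ≡ coord x j
      fixed-coord j∈ x fixed = ⇔→≡ (mk⇔
        (∈-resp (to x) x fixed ∘ Equivalence.to (∈⇔∈-image j∈ x))
        (Equivalence.from (∈⇔∈-image j∈ x) ∘ ∈-resp x (to x) (≈ᴹ-sym fixed)))

      fixes-singletons⇒identity : (∀ i → i ∈ to (singleton i)) → ∀ x → to x ≈ x
      fixes-singletons⇒identity i∈ x = ∈-extensional (to x) x λ i →
        ⇔-sym (∈⇔∈-image (i∈ i) x)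

    -- Automorphisms induced by permutations of the basis.

    permute : Permutation′ n → Vertex → Vertex
    -- The element `i` of `x` moves to `π ⟨$⟩ˡ i`, which witnesses that the image is nonzero.
    permute π x = vertex (coord x ∘ (π ⟨$⟩ʳ_)) (π ⟨$⟩ˡ i , trans (cong (coord x) (inverseʳ π)) i∈x)
      where
      i   = proj₁ (nonempty x)
      i∈x = proj₂ (nonempty x)

    coord-permute : ∀ π x i → coord (permute π x) i ≡ coord x (π ⟨$⟩ʳ i)
    coord-permute π x = coefficient-combination _

    permutation-automorphism : Permutation′ n → Automorphism G
    permutation-automorphism π = record
      { bijection = record
        { to        = permute π
        ; from      = permute π⁻¹
        ; to-cong   = λ {x} {y} → permute-cong π {x} {y}
        ; from-cong = λ {x} {y} → permute-cong π⁻¹ {x} {y}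
        ; inverse   =
            (λ {x} {y} y≈ → ≈ᴹ-trans (permute-cong π {y} {permute π⁻¹ x} y≈) (cancelˡ x)) ,
            (λ {x} {y} y≈ → ≈ᴹ-trans (permute-cong π⁻¹ {y} {permute π x} y≈) (cancelʳ x))
        }
      ; preserves = λ x y → mk⇔
          (λ (x≉y , i , xᵢ , yᵢ) →
            x≉y ∘ permute-injective x y , π ⟨$⟩ˡ i ,
            xᵢ ∘ trans (coordˡ x i) , yᵢ ∘ trans (coordˡ y i))
          (λ (x≉y , i , xᵢ , yᵢ) →
            x≉y ∘ permute-cong π {x} {y} , π ⟨$⟩ʳ i ,
            xᵢ ∘ trans (coord-permute π x i) , yᵢ ∘ trans (coord-permute π y i))
      }
      where
      π⁻¹ = flip π
      permute-cong : ∀ ρ {x y} → x ≈ y → permute ρ x ≈ permute ρ y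
      permute-cong ρ x≈y = combination-cong (λ i → coefficient-cong x≈y (ρ ⟨$⟩ʳ i))
      cancelˡ : ∀ x → permute π (permute π⁻¹ x) ≈ x
      cancelˡ x = coefficient-injective λ i →
        trans (coord-permute π (permute π⁻¹ x) i)
          (trans (coord-permute π⁻¹ x (π ⟨$⟩ʳ i)) (cong (coord x) (inverseˡ π)))
      cancelʳ : ∀ x → permute π⁻¹ (permute π x) ≈ x
      cancelʳ x = coefficient-injective λ i →
        trans (coord-permute π⁻¹ (permute π x) i)
          (trans (coord-permute π x (π ⟨$⟩ˡ i)) (cong (coord x) (inverseʳ π)))
      permute-injective : ∀ x y → permute π x ≈ permute π y → x ≈ y
      permute-injective x y eq =
        ≈ᴹ-trans (≈ᴹ-sym (cancelʳ x))
          (≈ᴹ-trans (permute-cong π⁻¹ {permute π x} {permute π y} eq) (cancelʳ y))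
      coordˡ : ∀ x i → coord x i ≡ coord (permute π x) (π ⟨$⟩ˡ i)
      coordˡ x i = sym (trans (coord-permute π x (π ⟨$⟩ˡ i)) (cong (coord x) (inverseʳ π)))

  -- The upper bound on the fixed number.

  every-2^p-set-is-fixing : ∀ {p} {b : Vector Carrierᴹ (suc p)} (basis : IsBasis V b) →
                    AllFixing (nonZeroComponentGraph V basis) (2 ^ p)
  every-2^p-set-is-fixing {p} basis D card σ fixesD = fixes-singletons⇒identity σ fixes-singleton
    where
    open Coordinates basis
    open Automorphism σ using (to)
    module card = Inverse card

    element : Fin (2 ^ p) → Graph.Vertex G
    element k = proj₁ (card.to k)

    fixes-singleton : ∀ i → i ∈ to (singleton i)
    fixes-singleton i with nonempty (to (singleton i))
    ... | j , j∈ with i ≟ j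
    ...   | yes refl = j∈
    -- If `{i}` moves to `{j}`, then `code` is an injection of `Fin (2 ^ p)` into itself that misses
    -- the zero vector, against the pigeonhole principle.
    ...   | no  i≢j  = contradiction avoids-zero (injective⇒hits code-injective (encode {p} (const false)))
      where
      deleted : Fin (2 ^ p) → Vector Bool p
      deleted k = removeAt (coord (element k)) i

      code : Fin (2 ^ p) → Fin (2 ^ p)
      code k = encode (deleted k)

      agree : ∀ k → coord (element k) i ≡ coord (element k) j
      agree k = fixed-coord σ j∈ (element k) (fixesD _ (proj₂ (card.to k)))

      code-injective : Injective _≡_ _≡_ code
      code-injective {k} {l} eq =
        trans (sym (card.strictlyInverseʳ k))
          (trans (card.from-cong (coefficient-injective
                   (≗-from-removeAt i≢j (coord (element k)) (coord (element l)) (agree k) (agree l)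
                     (encode-injective (deleted k) (deleted l) eq))))
                 (card.strictlyInverseʳ l))

      avoids-zero : ∀ k → encode {p} (const false) ≢ code k
      -- A zero deletion leaves entry `j` false, hence entry `i` too by `agree`, so the vertex would
      -- have no element.
      avoids-zero k eq with l , l∈ ← nonempty (element k) =
        contradiction
          (trans (≗-from-removeAt i≢j (const false) (coord (element k)) refl (agree k)
                   (encode-injective (const false) (deleted k) eq) l) l∈)
          λ ()

  -- The lower bound on the fixed number.

  ¬allFixing-below-2^p : ∀ {p} {b : Vector Carrierᴹ (suc (suc p))} (basis : IsBasis V b) →
    ∀ {j} → j < 2 ^ suc p → ¬ AllFixing (nonZeroComponentGraph V basis) j
  ¬allFixing-below-2^p {p} basis {j} j<2^1+p allFixing =
    contradiction (Equivalence.to (∈-singleton⇔ 0F 1F) 1∈0) λ ()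
    where
    open Coordinates basis
    open Graph G using (Vertex)

    τ : Permutation′ (suc (suc p))
    τ = transpose 0F 1F

    -- `pinch 0F` sends both `0F` and `1F` to zero, so vectors that factor through it are unchanged
    -- by the swap.
    pinch-τ : ∀ i → pinch 0F (τ ⟨$⟩ʳ i) ≡ pinch {suc p} 0F i
    pinch-τ zero          = refl
    pinch-τ (suc zero)    = refl
    pinch-τ (suc (suc i)) = refl

    -- Leaving out the code of the zero vector, `2 ^ suc p - 1` codes remain, enough for any
    -- `j < 2 ^ suc p`.
    index-data = <⇒injection-avoiding j<2^1+p (encode {suc p} (const false))
    index : Fin j → Fin (2 ^ suc p)
    index = proj₁ index-data

    index-nonzero : ∀ k → ∃[ i ] decode {suc p} (index k) i ≡ true
    index-nonzero k with any? (λ i → decode {suc p} (index k) i ≟ᵇ true)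
    ... | yes ∃i = ∃i
    ... | no  ∄i = contradiction
      (trans (sym (encode-decode {suc p} (index k))) (encode-cong λ i → ¬-not (∄i ∘ (i ,_))))
      (proj₂ (proj₂ index-data) k)

    coords : Fin j → Vector Bool (suc (suc p))
    coords k = decode (index k) ∘ pinch 0F

    element : Fin j → Vertex
    -- `pinch 0F (suc i)` computes to `i`, so a true entry at `i` of the decoded vector reappears at
    -- `suc i`.
    element k = vertex (coords k) (map suc id (index-nonzero k))

    element-injective : ∀ k l → proj₁ (element k) ≈ᴹ proj₁ (element l) → k ≡ l
    element-injective k l eq = proj₁ (proj₂ index-data)
      (decode-injective {suc p} λ i → expansion-unique (coords k) (coords l) eq (suc i))
      where open IsBasis basis

    D : VertexSet G
    D = record
      { _∋_    = λ x → ∃[ k ] proj₁ x ≈ᴹ proj₁ (element k)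
      ; ∋-resp = λ x≈y (k , x≈k) → k , ≈ᴹ-trans (≈ᴹ-sym x≈y) x≈k
      }

    card : HasCardinality G D j
    card = record
      { to        = λ k → element k , k , ≈ᴹ-refl
      ; from      = λ (_ , k , _) → k
      ; to-cong   = λ { refl → ≈ᴹ-refl }
      ; from-cong = λ { {_ , k , x≈k} {_ , l , y≈l} x≈y →
          element-injective k l (≈ᴹ-trans (≈ᴹ-sym x≈k) (≈ᴹ-trans x≈y y≈l)) }
      ; inverse   =
          (λ { {_ , k , x≈k} refl → ≈ᴹ-sym x≈k }) ,
          (λ { {k} {_ , l , y≈l} y≈k → element-injective l k (≈ᴹ-trans (≈ᴹ-sym y≈l) y≈k) })
      }

    τ-fixes-D : ∀ x → VertexSet._∋_ D x → proj₁ (permute τ x) ≈ᴹ proj₁ x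
    τ-fixes-D x (k , x≈k) = coefficient-injective λ i →
      trans (coord-permute τ x i) (trans (repeated (τ ⟨$⟩ʳ i))
        (trans (cong (decode (index k)) (pinch-τ i)) (sym (repeated i))))
      where
      repeated : ∀ i → coord x i ≡ coords k i
      repeated i = trans (IsBasis.coefficient-cong basis x≈k i) (coefficient-combination (coords k) i)

    1∈0 : 1F ∈ singleton 0F
    -- By assumption `τ` fixes `{0}`, since it fixes all of `D`; yet it carries `{0}` to `{1}`.
    1∈0 = ∈-resp (permute τ (singleton 0F)) (singleton 0F)
      (allFixing D card (permutation-automorphism τ) τ-fixes-D (singleton 0F))
      (trans (coord-permute τ (singleton 0F) 1F) (Equivalence.from (∈-singleton⇔ 0F 0F) refl))

theorem4p4 : ∀ {m ℓm : Level} (V : Module 𝔽₂ m ℓm) (n : ℕ) → n ≥ 3 →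
    (b : Vector (Module.Carrierᴹ V) n) (basis : IsBasis V b) →
    IsFixedNumber (nonZeroComponentGraph V basis) (2 ^ (n ∸ 1))
theorem4p4 V (suc zero) (s≤s ())
theorem4p4 V (suc (suc p)) _ b basis =
  -- `n ∸ 1` is `suc p` here, so the upper bound is taken at `suc p` and the lower bound at `p`.
  every-2^p-set-is-fixing V basis ,
  λ j allFixing → ≮⇒≥ λ j<2^1+p → ¬allFixing-below-2^p V basis j<2^1+p allFixing
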